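{- For any pair $m$ and $k$ of positive integers, there exists a constant $C=C(m,k)$ such that ${\rm sat}^*(n,mC_k)\le C\cdot n$ for all positive integers $n$.
   Context: For a poset $P=(P,\leqslant)$, a family $\mathcal{G}$ of sets is a (induced) copy of $P$ if there is a bijection $b:P\to\mathcal{G}$ such that $p\leqslant q$ if and only if $b(p)\subseteq b(q)$. A family $\mathcal{F}\subseteq 2^{[n]}$ (where $[n]=\{1,\dots,n\}$) is induced $P$-saturated if $\mathcal{F}$ contains no copy of $P$, but for every $G\in 2^{[n]}\setminus\mathcal{F}$ the family $\mathcal{F}\cup\{G\}$ contains a copy of $P$. The induced saturation number ${\rm sat}^*(n,P)$ is the minimum size of an induced $P$-saturated family $\mathcal{F}\subseteq 2^{[n]}$. $C_k$ denotes the chain (totally ordered poset) with $k$ elements. For posets $P,P'$, $P+P'$ is the disjoint union of $P$ and $P'$ with no element of $P$ comparable to any element of $P'$, and $mP$ denotes the disjoint union of $m$ pairwise incomparable copies of $P$. -}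

module Defs where

open import Data.Nat using (ℕ; zero; suc; _+_; _≤_)
open import Data.Bool using (Bool; true; false; if_then_else_; _∨_)
open import Data.Fin using (Fin)
import Data.Fin as Fin
open import Data.Fin.Subset using (Subset; _⊆_)
open import Data.Vec using (Vec; []; _∷_)
open import Data.Vec.Properties using (≡-dec)
open import Data.List using (List; []; _∷_; map; _++_)
open import Data.Nat.ListAction using (sum)
open import Data.Product using (_×_; _,_; Σ; ∃)
open import Relation.Binary.PropositionalEquality using (_≡_)
open import Relation.Nullary using (¬_)
open import Relation.Nullary.Decidable using (⌊_⌋)
import Data.Bool.Properties as BoolP
open import Function.Bundles using (_⇔_)
open import Function.Definitions using (Injective)

-- The poset m C_k : m pairwise incomparable chains with k elements each.
-- Element (i , a) is the a-th element of the i-th chain.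
MCk : ℕ → ℕ → Set
MCk m k = Fin m × Fin k

_≼_ : ∀ {m k} → MCk m k → MCk m k → Set
(i , a) ≼ (j , b) = (i ≡ j) × (a Fin.≤ b)

Family : ℕ → Set
Family n = Subset n → Bool

_∈F_ : ∀ {n} → Subset n → Family n → Set
X ∈F F = F X ≡ true

insert : ∀ {n} → Family n → Subset n → Family n
insert F G X = F X ∨ ⌊ ≡-dec BoolP._≟_ X G ⌋

ContainsCopy : ℕ → ℕ → ∀ {n} → Family n → Set
ContainsCopy m k {n} F =
  Σ (MCk m k → Subset n) λ b →
    Injective _≡_ _≡_ b
    × (∀ p → b p ∈F F)
    × (∀ p q → (p ≼ q) ⇔ (b p ⊆ b q))

Saturated : ℕ → ℕ → ∀ {n} → Family n → Set
Saturated m k {n} F =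
  ¬ ContainsCopy m k F
  × (∀ G → F G ≡ false → ContainsCopy m k (insert F G))

allSubsets : (n : ℕ) → List (Subset n)
allSubsets zero = [] ∷ []
allSubsets (suc n) = map (true ∷_) (allSubsets n) ++ map (false ∷_) (allSubsets n)

size : ∀ {n} → Family n → ℕ
size {n} F = sum (map (λ X → if F X then 1 else 0) (allSubsets n))

-- sat*(n, m C_k) ≤ s  (sat* is a minimum, so this holds iff some saturated
-- family has size ≤ s)
SatStarLe : ℕ → ℕ → ℕ → ℕ → Set
SatStarLe n m k s = Σ (Family n) λ F → Saturated m k F × size F ≤ s

{-# OPTIONS --safe #-}

-- Split the ground set as M ⊔ Q ⊔ R with |M| = m − 1 and |Q| = max(k − 2, 0), where R = {1, …, r}
-- is the large part.  The seed family consists of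
--   * m − 1 chains of "threads" {l} ∪ {1, …, u}, one for each l ∈ M, and
--   * "rungs", a family without k-chain: A ∪ {i} and M ∪ A ∪ (R ∖ {i}) for A ⊆ Q and i ∈ R,
--     where a distinguished element of Q decides which of the two shapes A gets
--     (only the sets {i} for k = 2, and no rungs for k = 1).
-- Each chain of a copy of m C_k has to use a thread, so m of them would put two incomparable sets
-- on one of the m − 1 chains: the seed is m C_k-free.  If G ∩ R contains some i and misses some j
-- with j + k ≤ i, and G is not a rung, then the rungs A ∪ {i} below G and M ∪ A ∪ (R ∖ {j})
-- above G complete G to a k-chain all of whose members contain i and miss j; it is therefore
-- incomparable to all threads with j < u ≤ j + k, and together they form a copy of m C_k.
-- So in any saturated family containing the seed every set is a rung or differs from an initial
-- segment of R only on M ∪ Q and a window of k elements, and there are only O(n) such sets.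

module Submission where

open import Defs
open import Data.Bool using (Bool; true; false; if_then_else_)
import Data.Bool.Properties as Bool
open import Data.Empty using (⊥-elim)
open import Data.Fin using (Fin; zero; suc; toℕ; fromℕ<)
import Data.Fin as Fin
import Data.Fin.Properties as Fin
open import Data.Fin.Subset using (Subset; _⊆_; ⊥; ⊤; ⁅_⁆; ∁; ∣_∣) renaming (_∈_ to _∈ˢ_; _∉_ to _∉ˢ_)
open import Data.Fin.Subset.Properties
  using (_⊆?_; ⊆-antisym; ⊆-reflexive; anySubset?; out⊆; in⊆in; drop-∷-⊆; p⊆q⇒∣p∣≤∣q∣; ∣p∣≤n; ⊥⊆; ⊆⊤;
         x∈⁅x⁆; x∈⁅y⁆⇒x≡y; x∉p⇒x∈∁p; x∈p⇒x∉∁p; ∁p⊆∁q⇒p⊇q)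
open import Data.List using (List; []; _∷_; map; _++_; length; cartesianProductWith; allFin; upTo)
import Data.List as List
import Data.List.Membership.DecPropositional as DecMembership
open import Data.List.Membership.Propositional using (_∈_; _∉_)
open import Data.List.Membership.Propositional.Properties
  using (∈-map⁺; ∈-++⁺ˡ; ∈-++⁺ʳ; ∈-++⁻; ∈-cartesianProductWith⁺; ∈-cartesianProductWith⁻; ∈-allFin; ∈-upTo⁺; ∈-lookup)
open import Data.List.Properties using (length-map; length-++; length-tabulate; map-++; map-∘)
open import Data.List.Relation.Unary.All as All using (All; []; _∷_)
import Data.List.Relation.Unary.All.Properties as All
open import Data.List.Relation.Unary.AllPairs as AllPairs using (AllPairs; []; _∷_)
import Data.List.Relation.Unary.AllPairs.Properties as AllPairs
open import Data.List.Relation.Unary.Any using (here; there)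
open import Data.Nat using (ℕ; zero; suc; pred; _+_; _*_; _^_; _∸_; _≤_; _<_; z≤n; s≤s)
open import Data.Nat.ListAction using (sum)
open import Data.Nat.ListAction.Properties using (sum-++)
open import Data.Nat.Properties
open import Data.Nat.Solver using (module +-*-Solver)
open import Data.Product using (Σ; ∃; ∃₂; _×_; _,_; proj₁; proj₂)
open import Data.Sum using (_⊎_; inj₁; inj₂; [_,_]′)
open import Data.Vec using (Vec; []; _∷_; lookup; tabulate; splitAt; here; there)
import Data.Vec as Vec
open import Data.Vec.Properties using (≡-dec; lookup∘tabulate)
open import Function using (_∘_; id; _⇔_; mk⇔; Equivalence)
open import Relation.Binary.PropositionalEquality
  using (_≡_; _≢_; refl; sym; trans; cong; cong₂; subst; subst₂; module ≡-Reasoning)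
open import Relation.Nullary using (¬_; Dec; yes; no; contradiction)
open import Relation.Nullary.Decidable using (⌊_⌋; map′; _×-dec_; _→-dec_)
open import Relation.Unary using (Decidable)

open import Algebra.Properties.CommutativeSemigroup +-commutativeSemigroup using (interchange)
open +-*-Solver using (solve; _:*_; _:+_; _:=_; con)

module _ {n : ℕ} where
  open DecMembership (≡-dec {n = n} Bool._≟_) public using () renaming (_∈?_ to _∈ᴸ?_)

private variable
  m k n r s s′ : ℕ

-- Inclusion of families and insertion of a set

infix 4 _≤F_
_≤F_ : Family n → Family n → Set
F ≤F F′ = ∀ X → X ∈F F → X ∈F F′

insert-⊇ : (F : Family n) (G : Subset n) → F ≤F insert F G
insert-⊇ F G X X∈F rewrite X∈F = refl

insert-∋ : (F : Family n) (G : Subset n) → G ∈F insert F G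
insert-∋ F G with ≡-dec Bool._≟_ G G
... | yes _  = Bool.∨-zeroʳ (F G)
... | no G≢G = ⊥-elim (G≢G refl)

∈F-insert⁻ : (F : Family n) (G : Subset n) {X : Subset n} → X ∈F insert F G → X ∈F F ⊎ X ≡ G
∈F-insert⁻ F G {X} X∈ with F X | ≡-dec Bool._≟_ X G
... | true  | _        = inj₁ refl
... | false | yes X≡G = inj₂ X≡G

insert-mono : {F F′ : Family n} (G : Subset n) → F ≤F F′ → insert F G ≤F insert F′ G
insert-mono {F = F} {F′} G F≤F′ X X∈ with ∈F-insert⁻ F G X∈
... | inj₁ X∈F = insert-⊇ F′ G X (F≤F′ X X∈F)
... | inj₂ refl = insert-∋ F′ G

containsCopy-mono : {F F′ : Family n} → F ≤F F′ → ContainsCopy m k F → ContainsCopy m k F′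
containsCopy-mono F≤F′ (b , inj , b∈F , emb) = b , inj , (λ p → F≤F′ _ (b∈F p)) , emb

-- Copies of m C_k

-- Injectivity comes for free: equal images contain each other, so reflecting the order both ways
-- puts the two elements on one chain with equal heights.
embedding⇒copy : (F : Family n) (b : MCk m k → Subset n) → (∀ p → b p ∈F F) →
                 (∀ p q → (p ≼ q) ⇔ (b p ⊆ b q)) → ContainsCopy m k F
embedding⇒copy F b b∈F emb = b , inj , b∈F , emb
  where
  inj : ∀ {p q} → b p ≡ b q → p ≡ q
  inj {p} {q} eq
    with refl , a≤a′ ← Equivalence.from (emb p q) (⊆-reflexive eq)
       | _ , a′≤a ← Equivalence.from (emb q p) (⊆-reflexive (sym eq))
    = cong (_ ,_) (Fin.≤-antisym a≤a′ a′≤a)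

infix 4 _⊏_
_⊏_ : Subset n → Subset n → Set
X ⊏ Y = X ⊆ Y × ¬ (Y ⊆ X)

-- Within a chain, strictness also reflects the order: `a′ < a` would make `c i a ⊆ c i a′`
-- impossible. Across chains, non-inclusion is assumed for all ordered pairs of indices, so it
-- covers both directions.
chains⇒copy : (F : Family n) (c : Fin m → Fin k → Subset n) → (∀ i a → c i a ∈F F) →
              (∀ i {a a′} → a Fin.< a′ → c i a ⊏ c i a′) →
              (∀ {i i′} a a′ → i ≢ i′ → ¬ (c i a ⊆ c i′ a′)) → ContainsCopy m k F
chains⇒copy {m = m} {k} F c c∈F strict incomp =
  embedding⇒copy F (λ (i , a) → c i a) (λ (i , a) → c∈F i a) (λ p q → mk⇔ (to p q) (from p q))
  where
  to : (p q : MCk m k) → p ≼ q → c (proj₁ p) (proj₂ p) ⊆ c (proj₁ q) (proj₂ q)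
  to (i , a) (.i , a′) (refl , a≤a′) with m≤n⇒m<n∨m≡n a≤a′
  ... | inj₁ a<a′ = proj₁ (strict i a<a′)
  ... | inj₂ a≡a′ = ⊆-reflexive (cong (c i) (Fin.toℕ-injective a≡a′))
  from : (p q : MCk m k) → c (proj₁ p) (proj₂ p) ⊆ c (proj₁ q) (proj₂ q) → p ≼ q
  from (i , a) (i′ , a′) le with i Fin.≟ i′
  ... | no i≢i′ = ⊥-elim (incomp a a′ i≢i′ le)
  ... | yes refl = refl , ≮⇒≥ (λ a′<a → proj₂ (strict i a′<a) le)

anyVec? : {A : Set} → (∀ {P : A → Set} → Decidable P → Dec (∃ P)) →
          ∀ {n} {P : Vec A n → Set} → Decidable P → Dec (∃ P)
anyVec? any? {zero}  P? = map′ ([] ,_) (λ { ([] , p) → p }) (P? [])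
anyVec? any? {suc n} P? =
  map′ (λ (x , xs , p) → x ∷ xs , p) (λ { (x ∷ xs , p) → x , xs , p })
       (any? λ x → anyVec? any? λ xs → P? (x ∷ xs))

-- A copy is searched for among `m` by `k` grids of subsets, which can be enumerated. A map agrees
-- with its grid only pointwise, hence the transports along `entry-grid`.
containsCopy? : ∀ m k (F : Family n) → Dec (ContainsCopy m k F)
containsCopy? {n} m k F = map′ fromGrid toGrid (anyVec? (anyVec? anySubset?) good?)
  where
  entry : Vec (Vec (Subset n) k) m → MCk m k → Subset n
  entry v (i , a) = lookup (lookup v i) a

  Good : Vec (Vec (Subset n) k) m → Set
  Good v = (∀ i a → entry v (i , a) ∈F F) ×
           (∀ i a j b → ((i , a) ≼ (j , b) → entry v (i , a) ⊆ entry v (j , b)) ×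
                        (entry v (i , a) ⊆ entry v (j , b) → (i , a) ≼ (j , b)))

  good? : Decidable Good
  good? v =
    (Fin.all? λ i → Fin.all? λ a → F (entry v (i , a)) Bool.≟ true) ×-dec
    (Fin.all? λ i → Fin.all? λ a → Fin.all? λ j → Fin.all? λ b →
      let below? = (i Fin.≟ j) ×-dec (a Fin.≤? b)
          sub?   = entry v (i , a) ⊆? entry v (j , b)
      in (below? →-dec sub?) ×-dec (sub? →-dec below?))

  fromGrid : ∃ Good → ContainsCopy m k F
  fromGrid (v , ∈F , emb) = embedding⇒copy F (entry v) (λ (i , a) → ∈F i a)
    λ (i , a) (j , b) → mk⇔ (proj₁ (emb i a j b)) (proj₂ (emb i a j b))

  toGrid : ContainsCopy m k F → ∃ Good
  toGrid (b , _ , b∈F , emb) =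
    grid ,
    (λ i a → subst (_∈F F) (sym (entry-grid (i , a))) (b∈F (i , a))) ,
    λ i a j a′ →
      (λ le → subst₂ _⊆_ (sym (entry-grid (i , a))) (sym (entry-grid (j , a′)))
                (Equivalence.to (emb (i , a) (j , a′)) le)) ,
      (λ le → Equivalence.from (emb (i , a) (j , a′))
                (subst₂ _⊆_ (entry-grid (i , a)) (entry-grid (j , a′)) le))
    where
    grid = tabulate λ i → tabulate λ a → b (i , a)
    entry-grid : ∀ p → entry grid p ≡ b p
    entry-grid (i , a) = trans (cong (λ row → lookup row a) (lookup∘tabulate _ i))
                               (lookup∘tabulate _ a)

-- Greedy saturation

∈-allSubsets : (X : Subset n) → X ∈ allSubsets n
∈-allSubsets []          = here refl
∈-allSubsets (true  ∷ X) = ∈-++⁺ˡ (∈-map⁺ (true ∷_) (∈-allSubsets X))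
∈-allSubsets (false ∷ X) = ∈-++⁺ʳ _ (∈-map⁺ (false ∷_) (∈-allSubsets X))

-- One pass suffices. A set is rejected only if inserting it creates a copy, and this copy survives
-- in every larger family; an accepted set stays in the final family.
greedy : ∀ m k (Gs : List (Subset n)) (F : Family n) → ¬ ContainsCopy m k F →
         Σ (Family n) λ F′ → F ≤F F′ × ¬ ContainsCopy m k F′ ×
           (∀ G → G ∈ Gs → F′ G ≡ false → ContainsCopy m k (insert F′ G))
greedy m k []       F free = F , (λ _ → id) , free , λ _ ()
greedy m k (G ∷ Gs) F free with containsCopy? m k (insert F G)
... | yes copy with F′ , F≤F′ , free′ , sat ← greedy m k Gs F free =
  F′ , F≤F′ , free′ , λ where
    .G (here refl) _ → containsCopy-mono (insert-mono G F≤F′) copy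
    X  (there X∈)  → sat X X∈
... | no free⁺ with F′ , F⁺≤F′ , free′ , sat ← greedy m k Gs (insert F G) free⁺ =
  F′ , (λ X X∈F → F⁺≤F′ X (insert-⊇ F G X X∈F)) , free′ , λ where
    .G (here refl) G∉F′ → contradiction (trans (sym (F⁺≤F′ G (insert-∋ F G))) G∉F′) λ ()
    X  (there X∈)  → sat X X∈

saturate : ∀ m k (F : Family n) → ¬ ContainsCopy m k F →
           Σ (Family n) λ F′ → F ≤F F′ × Saturated m k F′
saturate m k F free with F′ , F≤F′ , free′ , sat ← greedy m k (allSubsets _) F free =
  F′ , F≤F′ , free′ , λ G → sat G (∈-allSubsets G)

-- Size of a family

-- `size F` unfolds to `count F (allSubsets n)`; the free list argument makes induction over the
-- list possible.
count : Family n → List (Subset n) → ℕ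
count F Xs = sum (map (λ X → if F X then 1 else 0) Xs)

count-empty : (F : Family n) → (∀ X → ¬ (X ∈F F)) → ∀ Xs → count F Xs ≡ 0
count-empty F empty []       = refl
count-empty F empty (X ∷ Xs) with F X in eq
... | true  = ⊥-elim (empty X eq)
... | false = count-empty F empty Xs

count-cover : (F F₁ F₂ : Family n) → (∀ X → X ∈F F → X ∈F F₁ ⊎ X ∈F F₂) →
              ∀ Xs → count F Xs ≤ count F₁ Xs + count F₂ Xs
count-cover F F₁ F₂ cover []       = z≤n
count-cover F F₁ F₂ cover (X ∷ Xs) =
  ≤-trans (+-mono-≤ (one X) (count-cover F F₁ F₂ cover Xs))
          (≤-reflexive (interchange (ind F₁ X) (ind F₂ X) (count F₁ Xs) (count F₂ Xs)))
  where
  ind : Family _ → Subset _ → ℕ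
  ind F X = if F X then 1 else 0
  one : ∀ X → ind F X ≤ ind F₁ X + ind F₂ X
  one X with F X | F₁ X | F₂ X | cover X
  ... | false | _     | _     | _ = z≤n
  ... | true  | true  | _     | _ = s≤s z≤n
  ... | true  | false | true  | _ = ≤-refl
  ... | true  | false | false | c with c refl
  ...   | inj₁ ()
  ...   | inj₂ ()

size-∷ : (F : Family (suc n)) → size F ≡ size (F ∘ (true ∷_)) + size (F ∘ (false ∷_))
size-∷ {n} F = begin
  sum (map ind (map (true ∷_) Xs ++ map (false ∷_) Xs))
    ≡⟨ cong sum (map-++ ind (map (true ∷_) Xs) _) ⟩
  sum (map ind (map (true ∷_) Xs) ++ map ind (map (false ∷_) Xs))
    ≡⟨ sum-++ (map ind (map (true ∷_) Xs)) _ ⟩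
  sum (map ind (map (true ∷_) Xs)) + sum (map ind (map (false ∷_) Xs))
    ≡⟨ cong₂ (λ xs ys → sum xs + sum ys) (sym (map-∘ Xs)) (sym (map-∘ Xs)) ⟩
  size (F ∘ (true ∷_)) + size (F ∘ (false ∷_)) ∎
  where
  open ≡-Reasoning
  Xs = allSubsets n
  ind : Subset (suc n) → ℕ
  ind X = if F X then 1 else 0

-- This rests on `allSubsets` having no repetitions: `Y` lies in only one of the two halves of the
-- cube, and the other half contributes nothing.
size-subsingleton : (F : Family n) (Y : Subset n) → (∀ X → X ∈F F → X ≡ Y) → size F ≤ 1
size-subsingleton {zero}  F Y only with F []
... | true  = ≤-refl
... | false = z≤n
size-subsingleton {suc n} F (y ∷ Y) only = ≤-trans (≤-reflexive (size-∷ F)) (halves y only)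
  where
  halves : ∀ y → (∀ X → X ∈F F → X ≡ y ∷ Y) → size (F ∘ (true ∷_)) + size (F ∘ (false ∷_)) ≤ 1
  halves true only =
    +-mono-≤ (size-subsingleton (F ∘ (true ∷_)) Y λ X X∈ → cong Vec.tail (only _ X∈))
             (≤-reflexive (count-empty (F ∘ (false ∷_)) (λ X X∈ → contradiction (only _ X∈) λ ()) (allSubsets n)))
  halves false only =
    +-mono-≤ (≤-reflexive (count-empty (F ∘ (true ∷_)) (λ X X∈ → contradiction (only _ X∈) λ ()) (allSubsets n)))
             (size-subsingleton (F ∘ (false ∷_)) Y λ X X∈ → cong Vec.tail (only _ X∈))

fromList : List (Subset n) → Family n
fromList L X = ⌊ X ∈ᴸ? L ⌋

∈-fromList⁺ : {L : List (Subset n)} {X : Subset n} → X ∈ L → X ∈F fromList L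
∈-fromList⁺ {L = L} {X} X∈L with X ∈ᴸ? L
... | yes _  = refl
... | no X∉L = ⊥-elim (X∉L X∈L)

∈-fromList⁻ : {L : List (Subset n)} {X : Subset n} → X ∈F fromList L → X ∈ L
∈-fromList⁻ {L = L} {X} X∈ with X ∈ᴸ? L
... | yes X∈L = X∈L

-- Union bound by induction on `L`: each entry adds a family with at most one member. Repetitions in
-- `L` only weaken the bound.
size≤length : (F : Family n) (L : List (Subset n)) → (∀ X → X ∈F F → X ∈ L) → size F ≤ length L
size≤length F []      F⊆L = ≤-reflexive (count-empty F (λ X X∈ → contradiction (F⊆L X X∈) λ ()) (allSubsets _))
size≤length F (Y ∷ L) F⊆L =
  ≤-trans (count-cover F (fromList (Y ∷ [])) (fromList L) split (allSubsets _))
          (+-mono-≤ (size-subsingleton (fromList (Y ∷ [])) Y single)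
                    (size≤length (fromList L) L λ _ → ∈-fromList⁻))
  where
  split : ∀ X → X ∈F F → X ∈F fromList (Y ∷ []) ⊎ X ∈F fromList L
  split X X∈F with F⊆L X X∈F
  ... | here X≡Y  = inj₁ (∈-fromList⁺ (here X≡Y))
  ... | there X∈L = inj₂ (∈-fromList⁺ X∈L)
  single : ∀ X → X ∈F fromList (Y ∷ []) → X ≡ Y
  single X X∈ with ∈-fromList⁻ {L = Y ∷ []} X∈
  ... | here X≡Y = X≡Y

length-allSubsets : ∀ n → length (allSubsets n) ≡ 2 ^ n
length-allSubsets zero    = refl
length-allSubsets (suc n) = begin
  length (map (true ∷_) Xs ++ map (false ∷_) Xs)         ≡⟨ length-++ (map (true ∷_) Xs) ⟩
  length (map (true ∷_) Xs) + length (map (false ∷_) Xs) ≡⟨ cong₂ _+_ (length-map _ Xs) (length-map _ Xs) ⟩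
  length Xs + length Xs                                  ≡⟨ cong₂ _+_ (length-allSubsets n) (length-allSubsets n) ⟩
  2 ^ n + 2 ^ n                                          ≡⟨ cong (2 ^ n +_) (sym (+-identityʳ (2 ^ n))) ⟩
  2 ^ suc n                                              ∎
  where
  open ≡-Reasoning
  Xs = allSubsets n

-- Subsets of a disjoint union, and strict inclusion

infixr 5 _⊕_
_⊕_ : Subset s → Subset s′ → Subset (s + s′)
_⊕_ = Vec._++_

⊕-⊆⁺ : {p p′ : Subset s} {x x′ : Subset s′} → p ⊆ p′ → x ⊆ x′ → p ⊕ x ⊆ p′ ⊕ x′
⊕-⊆⁺ {p = []}        {[]}         p⊆ x⊆ = x⊆
⊕-⊆⁺ {p = false ∷ p} {_ ∷ p′}     p⊆ x⊆ = out⊆ (⊕-⊆⁺ (drop-∷-⊆ p⊆) x⊆)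
⊕-⊆⁺ {p = true ∷ p}  {true ∷ p′}  p⊆ x⊆ = in⊆in (⊕-⊆⁺ (drop-∷-⊆ p⊆) x⊆)
⊕-⊆⁺ {p = true ∷ p}  {false ∷ p′} p⊆ x⊆ = contradiction (p⊆ here) λ ()

⊕-⊆⁻ˡ : (p p′ : Subset s) {x x′ : Subset s′} → p ⊕ x ⊆ p′ ⊕ x′ → p ⊆ p′
⊕-⊆⁻ˡ (true ∷ p)  (true ∷ p′)  le here       = here
⊕-⊆⁻ˡ (true ∷ p)  (false ∷ p′) le here       = contradiction (le here) λ ()
⊕-⊆⁻ˡ (_ ∷ p)     (_ ∷ p′)     le (there x∈) = there (⊕-⊆⁻ˡ p p′ (drop-∷-⊆ le) x∈)

⊕-⊆⁻ʳ : (p p′ : Subset s) {x x′ : Subset s′} → p ⊕ x ⊆ p′ ⊕ x′ → x ⊆ x′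
⊕-⊆⁻ʳ []      []       le = le
⊕-⊆⁻ʳ (_ ∷ p) (_ ∷ p′) le = ⊕-⊆⁻ʳ p p′ (drop-∷-⊆ le)

⊆∧∣≡∣⇒≡ : {p p′ : Subset n} → p ⊆ p′ → ∣ p ∣ ≡ ∣ p′ ∣ → p ≡ p′
⊆∧∣≡∣⇒≡ {p = []}        {[]}         le eq = refl
⊆∧∣≡∣⇒≡ {p = true ∷ _}  {true ∷ _}   le eq = cong (true ∷_) (⊆∧∣≡∣⇒≡ (drop-∷-⊆ le) (suc-injective eq))
⊆∧∣≡∣⇒≡ {p = true ∷ _}  {false ∷ _}  le eq = contradiction (le here) λ ()
⊆∧∣≡∣⇒≡ {p = false ∷ _} {true ∷ _}   le eq = ⊥-elim (<⇒≢ (s≤s (p⊆q⇒∣p∣≤∣q∣ (drop-∷-⊆ le))) eq)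
⊆∧∣≡∣⇒≡ {p = false ∷ _} {false ∷ _}  le eq = cong (false ∷_) (⊆∧∣≡∣⇒≡ (drop-∷-⊆ le) eq)

⁅⁆⊆ : {i : Fin n} {t : Subset n} → i ∈ˢ t → ⁅ i ⁆ ⊆ t
⁅⁆⊆ {i = i} i∈t x∈ rewrite x∈⁅y⁆⇒x≡y i x∈ = i∈t

⊆∁⁅⁆ : {j : Fin n} {t : Subset n} → j ∉ˢ t → t ⊆ ∁ ⁅ j ⁆
⊆∁⁅⁆ {j = j} j∉t x∈t = x∉p⇒x∈∁p λ x∈ → j∉t (subst (_∈ˢ _) (x∈⁅y⁆⇒x≡y j x∈) x∈t)

⊆∧≢⇒⊏ : {X Y : Subset n} → X ⊆ Y → X ≢ Y → X ⊏ Y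
⊆∧≢⇒⊏ X⊆Y X≢Y = X⊆Y , λ Y⊆X → X≢Y (⊆-antisym X⊆Y Y⊆X)

⊏-trans : {X Y Z : Subset n} → X ⊏ Y → Y ⊏ Z → X ⊏ Z
⊏-trans {X = X} {Y} (X⊆Y , Y⊈X) (Y⊆Z , _) = (λ x∈ → Y⊆Z (X⊆Y x∈)) , λ Z⊆X → Y⊈X λ x∈ → Z⊆X (Y⊆Z x∈)

⊕-⊏ : {p p′ : Subset s} (x : Subset s′) → p ⊏ p′ → p ⊕ x ⊏ p′ ⊕ x
⊕-⊏ {p = p} {p′} x (p⊆ , ⊈p) = ⊕-⊆⁺ p⊆ id , λ le → ⊈p (⊕-⊆⁻ˡ p′ p le)

⊏-⊕ : (p : Subset s) {x x′ : Subset s′} → x ⊏ x′ → p ⊕ x ⊏ p ⊕ x′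
⊏-⊕ p (x⊆ , ⊈x) = ⊕-⊆⁺ {p = p} id x⊆ , λ le → ⊈x (⊕-⊆⁻ʳ p p le)

-- Initial segments

initial : ∀ r → ℕ → Subset r
initial zero    _       = []
initial (suc r) zero    = false ∷ initial r zero
initial (suc r) (suc u) = true ∷ initial r u

∈-initial⁺ : ∀ {u} {x : Fin r} → toℕ x < u → x ∈ˢ initial r u
∈-initial⁺ {u = suc u} {zero}  _         = here
∈-initial⁺ {u = suc u} {suc x} (s≤s x<u) = there (∈-initial⁺ x<u)

∈-initial⁻ : ∀ {u} {x : Fin r} → x ∈ˢ initial r u → toℕ x < u
∈-initial⁻ {u = suc u} {zero}  here       = s≤s z≤n
∈-initial⁻ {u = zero}  {suc x} (there x∈) = contradiction (∈-initial⁻ x∈) λ ()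
∈-initial⁻ {u = suc u} {suc x} (there x∈) = s≤s (∈-initial⁻ x∈)

initial-mono : ∀ {u v} → u ≤ v → initial r u ⊆ initial r v
initial-mono u≤v x∈ = ∈-initial⁺ (<-≤-trans (∈-initial⁻ x∈) u≤v)

-- The point with index `u` separates the two segments. It exists because `u < r`; beyond `r` the
-- segments no longer grow.
initial-⊏ : ∀ {u v} → u < v → u < r → initial r u ⊏ initial r v
initial-⊏ {r} {u} {v} u<v u<r = initial-mono (<⇒≤ u<v) , λ le →
  <-irrefl x≡u (∈-initial⁻ (le (∈-initial⁺ (subst (_< v) (sym x≡u) u<v))))
  where
  x≡u : toℕ (fromℕ< u<r) ≡ u
  x≡u = Fin.toℕ-fromℕ< u<r

-- Sets that differ from an initial segment only inside a short window

-- The gap leaves room for the `d` initial segments of lengths `j + 1` to `j + d`, all of which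
-- contain `j` and miss `i`. None of them is comparable to `t`.
Wide : ℕ → Subset r → Set
Wide {r} d t = Σ (Fin r) λ i → Σ (Fin r) λ j → i ∈ˢ t × j ∉ˢ t × toℕ j + d ≤ toℕ i

-- These are the sets whose elements all have index below `d`.
short : (d r : ℕ) → List (Subset r)
short d       zero    = [] ∷ []
short zero    (suc r) = map (false ∷_) (short zero r)
short (suc d) (suc r) = map (true ∷_) (short d r) ++ map (false ∷_) (short d r)

short-or-long : ∀ d (t : Subset r) → t ∈ short d r ⊎ Σ (Fin r) λ i → i ∈ˢ t × d ≤ toℕ i
short-or-long d       []          = inj₁ (here refl)
short-or-long zero    (true ∷ t)  = inj₂ (zero , here , z≤n)
short-or-long zero    (false ∷ t) with short-or-long zero t
... | inj₁ t∈           = inj₁ (∈-map⁺ _ t∈)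
... | inj₂ (i , i∈ , _) = inj₂ (suc i , there i∈ , z≤n)
short-or-long (suc d) (x ∷ t) with short-or-long d t
... | inj₂ (i , i∈ , d≤i) = inj₂ (suc i , there i∈ , s≤s d≤i)
... | inj₁ t∈ with x
...   | true  = inj₁ (∈-++⁺ˡ (∈-map⁺ _ t∈))
...   | false = inj₁ (∈-++⁺ʳ _ (∈-map⁺ _ t∈))

-- The recursion runs along the longest initial segment contained in the set; after the first
-- missing point, only the next `d` points may still occur.
narrow : (d r : ℕ) → List (Subset r)
narrow d zero    = [] ∷ []
narrow d (suc r) = map (true ∷_) (narrow d r) ++ map (false ∷_) (short d r)

-- The first missing point serves as `j`. An element at index `d` or more of the tail behind it is
-- at distance at least `d + 1` from it, hence the shift between `narrow d` and `Wide (suc d)`.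
narrow-or-wide : ∀ d (t : Subset r) → t ∈ narrow d r ⊎ Wide (suc d) t
narrow-or-wide d []          = inj₁ (here refl)
narrow-or-wide d (true ∷ t)  with narrow-or-wide d t
... | inj₁ t∈                        = inj₁ (∈-++⁺ˡ (∈-map⁺ _ t∈))
... | inj₂ (i , j , i∈ , j∉ , j+d≤i) = inj₂ (suc i , suc j , there i∈ , (λ { (there j∈) → j∉ j∈ }) , s≤s j+d≤i)
narrow-or-wide d (false ∷ t) with short-or-long d t
... | inj₁ t∈             = inj₁ (∈-++⁺ʳ _ (∈-map⁺ _ t∈))
... | inj₂ (i , i∈ , d≤i) = inj₂ (suc i , zero , there i∈ , (λ ()) , s≤s d≤i)

length-short : (d r : ℕ) → length (short d r) ≤ 2 ^ d
length-short d       zero    = m^n>0 2 d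
length-short zero    (suc r) = ≤-trans (≤-reflexive (length-map _ (short zero r))) (length-short zero r)
length-short (suc d) (suc r) = begin
  length (map (true ∷_) (short d r) ++ map (false ∷_) (short d r))
    ≡⟨ length-++ (map (true ∷_) (short d r)) ⟩
  length (map (true ∷_) (short d r)) + length (map (false ∷_) (short d r))
    ≡⟨ cong₂ _+_ (length-map _ (short d r)) (length-map _ (short d r)) ⟩
  length (short d r) + length (short d r)
    ≤⟨ +-mono-≤ (length-short d r) (≤-trans (length-short d r) (m≤m+n _ 0)) ⟩
  2 ^ suc d ∎
  where open ≤-Reasoning

-- There are `r + 1` possible lengths for the initial segment and at most `2 ^ d` fillings of the
-- window after it. This is the source of linearity.
length-narrow : (d r : ℕ) → length (narrow d r) ≤ suc r * 2 ^ d
length-narrow d zero    = ≤-trans (m^n>0 2 d) (m≤m+n _ 0)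
length-narrow d (suc r) = begin
  length (map (true ∷_) (narrow d r) ++ map (false ∷_) (short d r))
    ≡⟨ length-++ (map (true ∷_) (narrow d r)) ⟩
  length (map (true ∷_) (narrow d r)) + length (map (false ∷_) (short d r))
    ≡⟨ cong₂ _+_ (length-map _ (narrow d r)) (length-map _ (short d r)) ⟩
  length (narrow d r) + length (short d r)
    ≤⟨ +-mono-≤ (length-narrow d r) (length-short d r) ⟩
  suc r * 2 ^ d + 2 ^ d
    ≡⟨ +-comm (suc r * 2 ^ d) (2 ^ d) ⟩
  suc (suc r) * 2 ^ d ∎
  where open ≤-Reasoning

length-cartesianProductWith : {A B C : Set} (f : A → B → C) (xs : List A) (ys : List B) →
                              length (cartesianProductWith f xs ys) ≡ length xs * length ys
length-cartesianProductWith f []       ys = refl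
length-cartesianProductWith f (x ∷ xs) ys =
  trans (length-++ (map (f x) ys)) (cong₂ _+_ (length-map (f x) ys) (length-cartesianProductWith f xs ys))

-- Maximal chains of the cube through a given set

below : Subset n → List (Subset n)
below []          = [] ∷ []
below (false ∷ g) = map (false ∷_) (below g)
below (true ∷ g)  = map (false ∷_) (below g) ++ (true ∷ g) ∷ []

above : Subset n → List (Subset n)
above []          = [] ∷ []
above (true ∷ g)  = map (true ∷_) (above g)
above (false ∷ g) = (false ∷ g) ∷ map (true ∷_) (above g)

below-⊆ : (g : Subset n) → All (_⊆ g) (below g)
below-⊆ []          = id ∷ []
below-⊆ (false ∷ g) = All.map⁺ (All.map {P = _⊆ g} {Q = λ A → false ∷ A ⊆ false ∷ g} (λ le → out⊆ le) (below-⊆ g))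
below-⊆ (true ∷ g)  =
  All.++⁺ (All.map⁺ (All.map {P = _⊆ g} {Q = λ A → false ∷ A ⊆ true ∷ g} (λ le → out⊆ le) (below-⊆ g))) (id ∷ [])

above-⊇ : (g : Subset n) → All (g ⊆_) (above g)
above-⊇ []          = id ∷ []
above-⊇ (true ∷ g)  = All.map⁺ (All.map {P = g ⊆_} {Q = λ A → true ∷ g ⊆ true ∷ A} (λ le → in⊆in le) (above-⊇ g))
above-⊇ (false ∷ g) =
  id ∷ All.map⁺ (All.map {P = g ⊆_} {Q = λ A → false ∷ g ⊆ true ∷ A} (λ le → out⊆ le) (above-⊇ g))

∷-⊏ : (s : Bool) {p p′ : Subset n} → p ⊏ p′ → (s ∷ p) ⊏ (s ∷ p′)
∷-⊏ s = ⊏-⊕ (s ∷ [])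

out⊏in : {p p′ : Subset n} → p ⊆ p′ → (false ∷ p) ⊏ (true ∷ p′)
out⊏in le = out⊆ le , λ ge → contradiction (ge here) λ ()

below-chain : (g : Subset n) → AllPairs _⊏_ (below g)
below-chain []          = [] ∷ []
below-chain (false ∷ g) = AllPairs.map⁺ (AllPairs.map (∷-⊏ false) (below-chain g))
below-chain (true ∷ g)  =
  AllPairs.++⁺ (AllPairs.map⁺ (AllPairs.map (∷-⊏ false) (below-chain g))) ([] ∷ [])
               (All.map⁺ (All.map {P = _⊆ g} (λ le → out⊏in le ∷ []) (below-⊆ g)))

above-chain : (g : Subset n) → AllPairs _⊏_ (above g)
above-chain []          = [] ∷ []
above-chain (true ∷ g)  = AllPairs.map⁺ (AllPairs.map (∷-⊏ true) (above-chain g))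
above-chain (false ∷ g) =
  All.map⁺ (All.map {P = g ⊆_} (λ le → out⊏in le) (above-⊇ g)) ∷
  AllPairs.map⁺ (AllPairs.map (∷-⊏ true) (above-chain g))

-- The lists have `∣ g ∣ + 1` and `n - ∣ g ∣ + 1` members. The set `g` is counted in both on
-- purpose: it will give one low rung and one high rung.
length-below+above : (g : Subset n) → length (below g) + length (above g) ≡ suc (suc n)
length-below+above []          = refl
length-below+above (false ∷ g) =
  trans (cong₂ _+_ (length-map _ (below g)) (cong suc (length-map _ (above g))))
        (trans (+-suc (length (below g)) (length (above g))) (cong suc (length-below+above g)))
length-below+above (true ∷ g) =
  trans (cong₂ _+_ (trans (length-++ (map (false ∷_) (below g)))
                          (trans (cong (_+ 1) (length-map _ (below g))) (+-comm _ 1)))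
                   (length-map _ (above g)))
        (cong suc (length-below+above g))

lookup-AllPairs : {A : Set} {R : A → A → Set} {xs : List A} → AllPairs R xs →
                  ∀ {a b} → a Fin.< b → R (List.lookup xs a) (List.lookup xs b)
lookup-AllPairs (x~xs ∷ _) {zero}  {suc b} _         = All.lookup x~xs (∈-lookup b)
lookup-AllPairs (_ ∷ xs~)  {suc a} {suc b} (s≤s a<b) = lookup-AllPairs xs~ a<b

chain-family : {A : Set} {R : A → A → Set} {P : A → Set} {xs : List A} → length xs ≡ k →
               AllPairs R xs → All P xs →
               Σ (Fin k → A) λ c → (∀ {a b} → a Fin.< b → R (c a) (c b)) × (∀ a → P (c a))
chain-family {xs = xs} refl xs~ Pxs = List.lookup xs , lookup-AllPairs xs~ , λ a → All.lookup Pxs (∈-lookup a)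

-- The seed family; from here on m and k are one less than in m C_k

thread : (q r : ℕ) → Fin m → ℕ → Subset (m + (q + r))
thread q r l u = ⁅ l ⁆ ⊕ (⊥ {q} ⊕ initial r u)

-- Lengths below `r` are enough: those used later are at most the index of a point of R.
threads : (m q r : ℕ) → List (Subset (m + (q + r)))
threads m q r = cartesianProductWith (thread q r) (allFin m) (upTo r)

-- The first point of Q is the distinguished one. If Q is empty the shape is the low one, which
-- leaves only singletons of R as rungs.
high : Subset n → Bool
high []      = false
high (x ∷ _) = x

pad : (m : ℕ) → Bool → Subset m
pad m true  = ⊤
pad m false = ⊥

side : Bool → Fin r → Subset r
side true  i = ∁ ⁅ i ⁆
side false i = ⁅ i ⁆

rung : ∀ m {q r} → Subset q → Fin r → Subset (m + (q + r))
rung m A i = pad m (high A) ⊕ (A ⊕ side (high A) i)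

rungs : (m k r : ℕ) → List (Subset (m + (pred k + r)))
rungs m zero    r = []
rungs m (suc q) r = cartesianProductWith (rung m) (allSubsets q) (allFin r)

seed : (m k r : ℕ) → Family (m + (pred k + r))
seed m k r = fromList (threads m (pred k) r ++ rungs m k r)

∈-rungs : ∀ m {q r} (A : Subset q) (i : Fin r) → rung m A i ∈ rungs m (suc q) r
∈-rungs m A i = ∈-cartesianProductWith⁺ (rung m) (∈-allSubsets A) (∈-allFin i)

side-⊆ : ∀ x {i j : Fin r} → side x i ⊆ side x j → i ≡ j
side-⊆ true  {i} {j} le = sym (x∈⁅y⁆⇒x≡y i (∁p⊆∁q⇒p⊇q le (x∈⁅x⁆ j)))
side-⊆ false {i} {j} le = x∈⁅y⁆⇒x≡y j (le (x∈⁅x⁆ i))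

-- Inclusion and equal cardinality force `A ≡ B`, so both rungs have the same shape. Singletons form
-- an antichain, and so do their complements.
rung-⊆ : ∀ m {q r} (A B : Subset q) {i j : Fin r} → rung m A i ⊆ rung m B j → ∣ A ∣ ≡ ∣ B ∣ →
         rung m A i ≡ rung m B j
rung-⊆ m A B le ∣A∣≡∣B∣
  with A⊕⊆B⊕ ← ⊕-⊆⁻ʳ (pad m (high A)) (pad m (high B)) le
  with refl ← ⊆∧∣≡∣⇒≡ (⊕-⊆⁻ˡ A B A⊕⊆B⊕) ∣A∣≡∣B∣
  = cong (rung m A) (side-⊆ (high A) (⊕-⊆⁻ʳ A A A⊕⊆B⊕))

rung-⊏ : ∀ m {q r} (A B : Subset q) {i j : Fin r} {X Y : Subset (m + (q + r))} →
         X ≡ rung m A i → Y ≡ rung m B j → X ⊏ Y → ∣ A ∣ ≢ ∣ B ∣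
rung-⊏ m A B refl refl (X⊆Y , Y⊈X) ∣A∣≡∣B∣ = Y⊈X (⊆-reflexive (sym (rung-⊆ m A B X⊆Y ∣A∣≡∣B∣)))

-- Along a strict chain of rungs the sizes of the Q-parts are pairwise distinct. With `q` points in
-- Q there are only `q + 1` sizes for `q + 2` members.
rungs-chain : ∀ m k r (c : Fin (suc k) → Subset (m + (pred k + r))) →
              (∀ {a b} → a Fin.< b → c a ⊏ c b) → ¬ (∀ a → c a ∈ rungs m k r)
rungs-chain m zero    r c strict c∈ = contradiction (c∈ zero) λ ()
rungs-chain m (suc q) r c strict c∈ = collide (Fin.pigeonhole ≤-refl rank)
  where
  unpack : ∀ a → Σ (Subset q) λ A → Σ (Fin r) λ i → c a ≡ rung m A i
  unpack a with A , i , _ , _ , eq ← ∈-cartesianProductWith⁻ (rung m) (allSubsets q) (allFin r) (c∈ a) = A , i , eq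
  ∣A∣<1+q : ∀ a → ∣ proj₁ (unpack a) ∣ < suc q
  ∣A∣<1+q a = s≤s (∣p∣≤n (proj₁ (unpack a)))
  rank : Fin (suc (suc q)) → Fin (suc q)
  rank a = fromℕ< (∣A∣<1+q a)
  collide : ¬ ∃₂ λ a b → a Fin.< b × rank a ≡ rank b
  collide (a , b , a<b , eq) =
    rung-⊏ m (proj₁ (unpack a)) (proj₁ (unpack b)) (proj₂ (proj₂ (unpack a))) (proj₂ (proj₂ (unpack b))) (strict a<b)
      (Fin.fromℕ<-injective _ _ (∣A∣<1+q a) (∣A∣<1+q b) eq)

thread-comparable : ∀ q r (l : Fin m) u v →
                    thread q r l u ⊆ thread q r l v ⊎ thread q r l v ⊆ thread q r l u
thread-comparable q r l u v with ≤-total u v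
... | inj₁ u≤v = inj₁ (⊕-⊆⁺ {p = ⁅ l ⁆} id (⊕-⊆⁺ {p = ⊥ {q}} id (initial-mono u≤v)))
... | inj₂ v≤u = inj₂ (⊕-⊆⁺ {p = ⁅ l ⁆} id (⊕-⊆⁺ {p = ⊥ {q}} id (initial-mono v≤u)))

∀⊎⇒∃⊎∀ : {P Q : Fin n → Set} → (∀ a → P a ⊎ Q a) → (∃ P) ⊎ (∀ a → Q a)
∀⊎⇒∃⊎∀ {zero}  f = inj₂ λ ()
∀⊎⇒∃⊎∀ {suc n} f with f zero | ∀⊎⇒∃⊎∀ (f ∘ suc)
... | inj₁ p | _            = inj₁ (zero , p)
... | inj₂ _ | inj₁ (a , p) = inj₁ (suc a , p)
... | inj₂ q | inj₂ qs      = inj₂ λ { zero → q ; (suc a) → qs a }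

seed-free : ∀ m k r → ¬ ContainsCopy (suc m) (suc k) (seed m k r)
seed-free m k r (b , _ , b∈ , emb) = i≢i′ (comparable (thread-comparable (pred k) r l u u′))
  where
  OnThread : Subset (m + (pred k + r)) → Set
  OnThread X = Σ (Fin m) λ l → Σ ℕ λ u → X ≡ thread (pred k) r l u

  cases : ∀ i a → OnThread (b (i , a)) ⊎ b (i , a) ∈ rungs m k r
  cases i a with ∈-++⁻ (threads m (pred k) r) (∈-fromList⁻ (b∈ (i , a)))
  ... | inj₂ X∈ = inj₂ X∈
  ... | inj₁ X∈ with l , u , _ , _ , eq ← ∈-cartesianProductWith⁻ (thread (pred k) r) (allFin m) (upTo r) X∈ =
    inj₁ (l , u , eq)

  strict : ∀ i {a a′} → a Fin.< a′ → b (i , a) ⊏ b (i , a′)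
  strict i {a} {a′} a<a′ = Equivalence.to (emb (i , a) (i , a′)) (refl , <⇒≤ a<a′) ,
    λ le → <⇒≱ a<a′ (proj₂ (Equivalence.from (emb (i , a′) (i , a)) le))

  meets : ∀ i → Σ (Fin (suc k)) λ a → OnThread (b (i , a))
  meets i with ∀⊎⇒∃⊎∀ (cases i)
  ... | inj₁ found = found
  ... | inj₂ all   = ⊥-elim (rungs-chain m k r (λ a → b (i , a)) (strict i) all)

  -- Each of the `m + 1` chains of the copy has selected one of `m` points of M, so two chains
  -- select the same one.
  collision = Fin.pigeonhole ≤-refl (λ i → proj₁ (proj₂ (meets i)))
  i  = proj₁ collision
  i′ = proj₁ (proj₂ collision)
  i≢i′ : i ≢ i′
  i≢i′ = Fin.<⇒≢ (proj₁ (proj₂ (proj₂ collision)))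
  l  = proj₁ (proj₂ (meets i))
  u  = proj₁ (proj₂ (proj₂ (meets i)))
  u′ = proj₁ (proj₂ (proj₂ (meets i′)))
  eq : b (i , proj₁ (meets i)) ≡ thread (pred k) r l u
  eq = proj₂ (proj₂ (proj₂ (meets i)))
  eq′ : b (i′ , proj₁ (meets i′)) ≡ thread (pred k) r l u′
  eq′ = trans (proj₂ (proj₂ (proj₂ (meets i′))))
              (cong (λ l → thread (pred k) r l u′) (sym (proj₂ (proj₂ (proj₂ collision)))))

  comparable : thread (pred k) r l u ⊆ thread (pred k) r l u′ ⊎ thread (pred k) r l u′ ⊆ thread (pred k) r l u → i ≡ i′
  comparable (inj₁ le) = proj₁ (Equivalence.from (emb _ _) (subst₂ _⊆_ (sym eq) (sym eq′) le))
  comparable (inj₂ ge) = sym (proj₁ (Equivalence.from (emb _ _) (subst₂ _⊆_ (sym eq′) (sym eq) ge)))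

-- Saturation

-- This is what makes the members of the chain through `G` incomparable to the chosen threads.
Separates : ∀ m q {r} → Fin r → Fin r → Subset (m + (q + r)) → Set
Separates m q {r} i j X =
  Σ (Subset m) λ p → Σ (Subset q) λ g → Σ (Subset r) λ t → X ≡ p ⊕ (g ⊕ t) × i ∈ˢ t × j ∉ˢ t

ChainThrough : ∀ m k {r} → Fin r → Fin r → Subset (m + (pred k + r)) → Set
ChainThrough m k {r} i j G = Σ (List (Subset (m + (pred k + r)))) λ Xs →
  length Xs ≡ suc k × AllPairs _⊏_ Xs ×
  All (λ X → (X ≡ G ⊎ X ∈ rungs m k r) × Separates m (pred k) i j X) Xs

-- For one-element chains `G` alone will do, and for two-element chains `{i}` is put below it.
-- Otherwise a maximal chain of subsets of the rest of Q passes through `g`: its part up to `g`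
-- gives low rungs and its part from `g` on gives high rungs, `q + 2` in all. The distinguished
-- point is left out below `G` and included above it, so both values of `x` fit. Inclusions are
-- strict since `G` is not a rung.
chain-through : ∀ m k {r} {i j : Fin r} (p : Subset m) (g : Subset (pred k)) (t : Subset r) →
                i ∈ˢ t → j ∉ˢ t → p ⊕ (g ⊕ t) ∉ rungs m k r → ChainThrough m k i j (p ⊕ (g ⊕ t))
chain-through m zero p g t i∈t j∉t G∉ =
  (p ⊕ (g ⊕ t)) ∷ [] , refl , [] ∷ [] , (inj₁ refl , p , g , t , refl , i∈t , j∉t) ∷ []
chain-through m (suc zero) {i = i} {j} p [] t i∈t j∉t G∉ =
  rung m [] i ∷ (p ⊕ t) ∷ [] , refl ,
  (⊆∧≢⇒⊏ (⊕-⊆⁺ {p = ⊥} {p} ⊥⊆ (⁅⁆⊆ i∈t)) (λ eq → G∉ (subst (_∈ rungs m 1 _) eq (∈-rungs m [] i))) ∷ []) ∷ [] ∷ [] ,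
  (inj₂ (∈-rungs m [] i) , ⊥ , [] , ⁅ i ⁆ , refl , x∈⁅x⁆ i , λ j∈ → j∉t (⁅⁆⊆ i∈t j∈)) ∷
  (inj₁ refl , p , [] , t , refl , i∈t , j∉t) ∷ []
chain-through m (suc (suc q)) {r} {i} {j} p (x ∷ g) t i∈t j∉t G∉ =
  lows ++ G ∷ highs , length≡ , pairs , All.++⁺ low-links (G-link ∷ high-links)
  where
  G = p ⊕ ((x ∷ g) ⊕ t)
  low upp : Subset q → Subset (m + (suc q + r))
  low A = rung m (false ∷ A) i
  upp A = rung m (true ∷ A) j
  lows  = map low (below g)
  highs = map upp (above g)

  Link : Subset (m + (suc q + r)) → Set
  Link X = (X ≡ G ⊎ X ∈ rungs m (suc (suc q)) r) × Separates m (suc q) i j X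

  length≡ : length (lows ++ G ∷ highs) ≡ suc (suc (suc q))
  length≡ = trans (length-++ lows)
    (trans (cong₂ (λ u v → u + suc v) (length-map low (below g)) (length-map upp (above g)))
    (trans (+-suc (length (below g)) (length (above g))) (cong suc (length-below+above g))))

  low⊏G : ∀ {A} → A ⊆ g → low A ⊏ G
  low⊏G {A} A⊆g = ⊆∧≢⇒⊏
    (⊕-⊆⁺ {p = ⊥} {p} ⊥⊆ (⊕-⊆⁺ {p = false ∷ A} {x ∷ g} (out⊆ A⊆g) (⁅⁆⊆ i∈t)))
    λ eq → G∉ (subst (_∈ rungs m (suc (suc q)) r) eq (∈-rungs m (false ∷ A) i))

  ∷⊆true∷ : ∀ x {A} → g ⊆ A → x ∷ g ⊆ true ∷ A
  ∷⊆true∷ true  le = in⊆in le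
  ∷⊆true∷ false le = out⊆ le

  G⊏high : ∀ {A} → g ⊆ A → G ⊏ upp A
  G⊏high {A} g⊆A = ⊆∧≢⇒⊏
    (⊕-⊆⁺ {p = p} {⊤} ⊆⊤ (⊕-⊆⁺ {p = x ∷ g} {true ∷ A} (∷⊆true∷ x g⊆A) (⊆∁⁅⁆ j∉t)))
    λ eq → G∉ (subst (_∈ rungs m (suc (suc q)) r) (sym eq) (∈-rungs m (true ∷ A) j))

  G⊏highs : All (G ⊏_) highs
  G⊏highs = All.map⁺ (All.map {P = g ⊆_} (λ g⊆A → G⊏high g⊆A) (above-⊇ g))

  pairs : AllPairs _⊏_ (lows ++ G ∷ highs)
  pairs = AllPairs.++⁺
    (AllPairs.map⁺ (AllPairs.map (λ A⊏B → ⊏-⊕ ⊥ (⊕-⊏ ⁅ i ⁆ (∷-⊏ false A⊏B))) (below-chain g)))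
    (G⊏highs ∷ AllPairs.map⁺ (AllPairs.map (λ A⊏B → ⊏-⊕ ⊤ (⊕-⊏ (∁ ⁅ j ⁆) (∷-⊏ true A⊏B))) (above-chain g)))
    -- Low rungs are compared with high rungs through `G`.
    (All.map⁺ (All.map {P = _⊆ g} (λ A⊆g → low⊏G A⊆g ∷ All.map (⊏-trans (low⊏G A⊆g)) G⊏highs) (below-⊆ g)))

  G-link : Link G
  G-link = inj₁ refl , p , x ∷ g , t , refl , i∈t , j∉t

  low-links : All Link lows
  low-links = All.map⁺ (All.universal (λ A →
    inj₂ (∈-rungs m (false ∷ A) i) , ⊥ , false ∷ A , ⁅ i ⁆ , refl , x∈⁅x⁆ i , λ j∈ → j∉t (⁅⁆⊆ i∈t j∈)) (below g))

  high-links : All Link highs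
  high-links = All.map⁺ (All.universal (λ A →
    inj₂ (∈-rungs m (true ∷ A) j) , ⊤ , true ∷ A , ∁ ⁅ j ⁆ , refl , ⊆∁⁅⁆ j∉t i∈t , x∈p⇒x∉∁p (x∈⁅x⁆ j)) (above g))

wide⇒copy : ∀ m k {r} (p : Subset m) (g : Subset (pred k)) (t : Subset r) → Wide (suc k) t →
            p ⊕ (g ⊕ t) ∉ rungs m k r →
            ContainsCopy (suc m) (suc k) (insert (seed m k r) (p ⊕ (g ⊕ t)))
wide⇒copy m k {r} p g t (i , j , i∈t , j∉t , j+k<i) G∉ =
  let Xs , len , pairs , links = chain-through m k p g t i∈t j∉t G∉
      c , c-strict , c-link = chain-family len pairs links
  in copy c c-strict c-link
  where
  G = p ⊕ (g ⊕ t)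
  q = pred k
  S = insert (seed m k r) G

  copy : (c : Fin (suc k) → Subset (m + (q + r))) → (∀ {a b} → a Fin.< b → c a ⊏ c b) →
         (∀ a → (c a ≡ G ⊎ c a ∈ rungs m k r) × Separates m q i j (c a)) → ContainsCopy (suc m) (suc k) S
  copy c c-strict c-link = chains⇒copy S d d∈ d-strict d-incomp
    where
    -- The lengths run from `j + 1` to `j + k + 1`. The first already includes the point `j`, and
    -- the last is at most `i`, so every segment misses `i`.
    pos : Fin (suc k) → ℕ
    pos a = suc (toℕ j) + toℕ a

    pos≤i : ∀ a → pos a ≤ toℕ i
    pos≤i a = ≤-trans (≤-reflexive (sym (+-suc (toℕ j) (toℕ a))))
                      (≤-trans (+-monoʳ-≤ (toℕ j) (Fin.toℕ<n a)) j+k<i)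

    pos<r : ∀ a → pos a < r
    pos<r a = ≤-<-trans (pos≤i a) (Fin.toℕ<n i)

    d : Fin (suc m) → Fin (suc k) → Subset (m + (q + r))
    d zero    a = c a
    d (suc l) a = thread q r l (pos a)

    d∈ : ∀ l a → d l a ∈F S
    d∈ zero a with proj₁ (c-link a)
    ... | inj₁ eq = subst (_∈F S) (sym eq) (insert-∋ (seed m k r) G)
    ... | inj₂ c∈ = insert-⊇ (seed m k r) G _ (∈-fromList⁺ (∈-++⁺ʳ (threads m q r) c∈))
    d∈ (suc l) a = insert-⊇ (seed m k r) G _
      (∈-fromList⁺ (∈-++⁺ˡ (∈-cartesianProductWith⁺ (thread q r) (∈-allFin l) (∈-upTo⁺ (pos<r a)))))

    d-strict : ∀ l {a b} → a Fin.< b → d l a ⊏ d l b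
    d-strict zero        a<b = c-strict a<b
    d-strict (suc l) {a} a<b =
      ⊏-⊕ ⁅ l ⁆ (⊏-⊕ (⊥ {q}) (initial-⊏ (+-monoʳ-< (suc (toℕ j)) a<b) (pos<r a)))

    -- The witnesses against inclusion are `i` for a chain member in a thread, `j` for a thread in a
    -- chain member, and the point of M for two threads.
    d-incomp : ∀ {l l′} a b → l ≢ l′ → ¬ (d l a ⊆ d l′ b)
    d-incomp {zero} {zero} a b l≢l′ _ = l≢l′ refl
    d-incomp {zero} {suc l′} a b _ le
      with p′ , g′ , t′ , eq , i∈t′ , _ ← proj₂ (c-link a) rewrite eq
      = <⇒≱ (∈-initial⁻ (⊕-⊆⁻ʳ g′ ⊥ (⊕-⊆⁻ʳ p′ ⁅ l′ ⁆ le) i∈t′)) (pos≤i b)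
    d-incomp {suc l} {zero} a b _ le
      with p′ , g′ , t′ , eq , _ , j∉t′ ← proj₂ (c-link b) rewrite eq
      = j∉t′ (⊕-⊆⁻ʳ ⊥ g′ (⊕-⊆⁻ʳ ⁅ l ⁆ p′ le) (∈-initial⁺ (s≤s (m≤m+n (toℕ j) (toℕ a)))))
    d-incomp {suc l} {suc l′} a b l≢l′ le =
      l≢l′ (cong suc (x∈⁅y⁆⇒x≡y l′ (⊕-⊆⁻ˡ ⁅ l ⁆ ⁅ l′ ⁆ le (x∈⁅x⁆ l))))

-- The linear bound

cover : (m k r : ℕ) → List (Subset (m + (pred k + r)))
cover m k r =
  cartesianProductWith _⊕_ (allSubsets m)
    (cartesianProductWith _⊕_ (allSubsets (pred k)) (narrow k r)) ++ rungs m k r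

-- If `X` were wide and not a rung, the seed together with `X` would contain a copy, and `F`
-- includes both.
saturated⊆cover : ∀ m k r {F : Family (m + (pred k + r))} → seed m k r ≤F F →
                  ¬ ContainsCopy (suc m) (suc k) F → ∀ X → X ∈F F → X ∈ cover m k r
saturated⊆cover m k r {F} seed≤F free X X∈F
  with p , y , refl ← splitAt m X
  with g , t , refl ← splitAt (pred k) y
  with narrow-or-wide k t | (p ⊕ (g ⊕ t)) ∈ᴸ? rungs m k r
... | _ | yes X∈ = ∈-++⁺ʳ (cartesianProductWith _⊕_ (allSubsets m) _) X∈
... | inj₁ t∈ | no _ =
  ∈-++⁺ˡ (∈-cartesianProductWith⁺ _⊕_ (∈-allSubsets p) (∈-cartesianProductWith⁺ _⊕_ (∈-allSubsets g) t∈))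
... | inj₂ wide | no X∉ = ⊥-elim (free (containsCopy-mono insert≤F (wide⇒copy m k p g t wide X∉)))
  where
  insert≤F : insert (seed m k r) (p ⊕ (g ⊕ t)) ≤F F
  insert≤F Y Y∈ with ∈F-insert⁻ (seed m k r) (p ⊕ (g ⊕ t)) Y∈
  ... | inj₁ Y∈seed = seed≤F Y Y∈seed
  ... | inj₂ refl   = X∈F

length-rungs : (m k r : ℕ) → length (rungs m k r) ≤ 2 ^ pred k * r
length-rungs m zero    r = z≤n
length-rungs m (suc q) r = ≤-reflexive
  (trans (length-cartesianProductWith (rung m) (allSubsets q) (allFin r))
         (cong₂ _*_ (length-allSubsets q) (length-tabulate id)))

length-cover : ∀ m k r → length (cover m k r) ≤ 2 ^ m * (2 ^ pred k * (suc r * 2 ^ k)) + 2 ^ pred k * r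
length-cover m k r = begin
  length (narrows ++ rungs m k r)
    ≡⟨ length-++ narrows ⟩
  length narrows + length (rungs m k r)
    ≡⟨ cong (_+ length (rungs m k r)) length-narrows ⟩
  2 ^ m * (2 ^ pred k * length (narrow k r)) + length (rungs m k r)
    ≤⟨ +-mono-≤ (*-monoʳ-≤ (2 ^ m) (*-monoʳ-≤ (2 ^ pred k) (length-narrow k r))) (length-rungs m k r) ⟩
  2 ^ m * (2 ^ pred k * (suc r * 2 ^ k)) + 2 ^ pred k * r ∎
  where
  open ≤-Reasoning
  tails = cartesianProductWith _⊕_ (allSubsets (pred k)) (narrow k r)
  narrows = cartesianProductWith _⊕_ (allSubsets m) tails
  length-narrows : length narrows ≡ 2 ^ m * (2 ^ pred k * length (narrow k r))
  length-narrows = trans (length-cartesianProductWith _⊕_ (allSubsets m) tails)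
    (cong₂ _*_ (length-allSubsets m)
      (trans (length-cartesianProductWith _⊕_ (allSubsets (pred k)) (narrow k r))
             (cong (_* length (narrow k r)) (length-allSubsets (pred k)))))

-- The last summand serves ground sets with fewer than m + pred k elements.
bound : ℕ → ℕ → ℕ
bound m k = 2 ^ m * (2 ^ pred k * (2 * 2 ^ k)) + 2 ^ pred k + 2 ^ (m + pred k)

length-cover≤bound : ∀ m k r n → m + (pred k + r) ≡ suc n → length (cover m k r) ≤ bound m k * suc n
length-cover≤bound m k r n eq = begin
  length (cover m k r)                                  ≤⟨ length-cover m k r ⟩
  a * (b * (suc r * c)) + b * r                         ≤⟨ +-mono-≤ (*-monoʳ-≤ a (*-monoʳ-≤ b (*-monoˡ-≤ c suc-r≤))) (*-monoʳ-≤ b r≤) ⟩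
  a * (b * (2 * suc n * c)) + b * suc n                 ≡⟨ regroup ⟩
  (a * (b * (2 * c)) + b) * suc n                       ≤⟨ *-monoˡ-≤ (suc n) (m≤m+n (a * (b * (2 * c)) + b) (2 ^ (m + pred k))) ⟩
  bound m k * suc n                                     ∎
  where
  open ≤-Reasoning
  a = 2 ^ m
  b = 2 ^ pred k
  c = 2 ^ k
  r≤ : r ≤ suc n
  r≤ = ≤-trans (≤-trans (m≤n+m r (pred k)) (m≤n+m (pred k + r) m)) (≤-reflexive eq)
  regroup : a * (b * (2 * suc n * c)) + b * suc n ≡ (a * (b * (2 * c)) + b) * suc n
  regroup = solve 4 (λ a b c n → a :* (b :* (con 2 :* n :* c)) :+ b :* n
                                   := (a :* (b :* (con 2 :* c)) :+ b) :* n) refl a b c (suc n)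
  -- The extra 1 is absorbed by a second `suc n`, which explains the factor 2 in `bound` and avoids
  -- an additive constant.
  suc-r≤ : suc r ≤ 2 * suc n
  suc-r≤ = +-mono-≤ {1} {suc n} (s≤s z≤n) (≤-trans r≤ (m≤m+n (suc n) 0))

large : ∀ m k r n → m + (pred k + r) ≡ suc n → SatStarLe (suc n) (suc m) (suc k) (bound m k * suc n)
large m k r n eq = subst (λ N → SatStarLe N (suc m) (suc k) (bound m k * suc n)) eq
  (let F , seed≤F , sat = saturate (suc m) (suc k) (seed m k r) (seed-free m k r)
   in F , sat , ≤-trans (size≤length F (cover m k r) (saturated⊆cover m k r seed≤F (proj₁ sat)))
                        (length-cover≤bound m k r n eq))

-- Any saturated family will do here, since the whole cube has boundedly many members in terms of
-- `m` and `k`. The greedy process starts from the empty family.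
small : ∀ m k n → suc n ≤ m + pred k → SatStarLe (suc n) (suc m) (suc k) (bound m k * suc n)
small m k n n<
  with F , _ , sat ← saturate (suc m) (suc k) (λ (_ : Subset (suc n)) → false)
                       (λ (_ , _ , b∈ , _) → contradiction (b∈ (zero , zero)) λ ()) =
  F , sat , (begin
    size F                         ≤⟨ size≤length F (allSubsets (suc n)) (λ X _ → ∈-allSubsets X) ⟩
    length (allSubsets (suc n))    ≡⟨ length-allSubsets (suc n) ⟩
    2 ^ suc n                      ≤⟨ ^-monoʳ-≤ 2 n< ⟩
    2 ^ (m + pred k)               ≤⟨ m≤n+m _ (2 ^ m * (2 ^ pred k * (2 * 2 ^ k)) + 2 ^ pred k) ⟩
    bound m k                      ≤⟨ m≤m*n (bound m k) (suc n) ⟩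
    bound m k * suc n              ∎)
  where open ≤-Reasoning

theorem1p4 : (m k : ℕ) → Σ ℕ λ C → (n : ℕ) →
    SatStarLe (suc n) (suc m) (suc k) (C * suc n)
theorem1p4 m k = bound m k , λ n →
  -- R receives the points left over by M and Q, possibly none.
  [ small m k n
  , (λ le → large m k (suc n ∸ (m + pred k)) n
              (trans (sym (+-assoc m (pred k) _)) (m+[n∸m]≡n le)))
  ]′ (≤-total (suc n) (m + pred k))
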